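{- Let $K\subseteq\mathbb{R}^d$ be a convex body containing the origin, let $\Lambda\subseteq\mathbb{R}^d$ be a lattice, let $V\subseteq\mathbb{R}^d$ be a rational linear subspace with $\dim V=\ell$, and let $i\in\{1,\dots,d\}$. Let $\pi_V$ denote the orthogonal projection of $\mathbb{R}^d$ onto $V$ and $V^\perp$ the orthogonal complement of $V$. Then $$\mu_i(K,\Lambda)\leqslant \max_{\substack{0\le j\le \ell\\ 0\le i-j\le d-\ell}} \Big(\mu_j(\pi_V(K),\pi_V(\Lambda))+\mu_{i-j}(K\cap V^\perp,\Lambda\cap V^\perp)\Big).$$
   Context: A convex body is a full-dimensional compact convex set; a lattice is a full-rank discrete subgroup. A linear subspace $V$ is rational (with respect to $\Lambda$) if it is spanned by vectors of $\Lambda$; then $\pi_V(\Lambda)$ is a lattice in $V$ and $\Lambda\cap V^\perp$ is a lattice in $V^\perp$. For a $k$-dimensional real vector space $W$, a lattice $\Gamma\subseteq W$, a compact convex set $C\subseteq W$ and $i\in\{1,\dots,k\}$, the $i$-th covering minimum is $\mu_i(C,\Gamma)=\min\{\mu\ge 0: (\mu C+\Gamma)\cap U\neq\emptyset \text{ for every affine subspace } U\subseteq W \text{ of dimension } k-i\}$; by convention $\mu_0(C,\Gamma)=0$. The covering minima of $\pi_V(K)$ and $\pi_V(\Lambda)$ are taken inside $V$, and those of $K\cap V^\perp$ and $\Lambda\cap V^\perp$ inside $V^\perp$. -}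

module Defs where

open import Algebra.Bundles using (CommutativeRing)
import Algebra.Definitions.RawMonoid as RawMonoidDefinitions
open import Axiom.ExcludedMiddle using (ExcludedMiddle)
open import Data.Fin.Base using (Fin)
open import Data.List.Base using (List; map; filter; upTo)
import Data.List.Extrema as Extrema
open import Data.List.Relation.Unary.Any using (Any)
open import Data.Nat.Base as ℕ using (ℕ; zero; suc; _∸_)
import Data.Nat.Properties as ℕ
open import Data.Product.Base using (∃; ∃-syntax; _×_; _,_; proj₁; proj₂)
open import Data.Vec.Functional using (Vector; replicate; zipWith)
import Data.Vec.Functional as Vector
open import Data.Vec.Functional.Relation.Binary.Pointwise using (Pointwise)
open import Level using (0ℓ) renaming (suc to lsuc)
open import Relation.Binary.Bundles using (TotalOrder)
open import Relation.Binary.Core using (Rel)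
open import Relation.Binary.Definitions using (_Respects_)
import Relation.Binary.Construct.Add.Supremum.Equality as AddSupEquality
import Relation.Binary.Construct.Add.Supremum.NonStrict as AddSupOrder
import Relation.Binary.Construct.NonStrictToStrict as NonStrictToStrict
open import Relation.Binary.Structures using (IsTotalOrder)
open import Relation.Nullary.Construct.Add.Supremum using (_⁺; [_]; ⊤⁺)
open import Relation.Nullary.Decidable.Core using (Dec; yes; no; _×-dec_)
open import Relation.Nullary.Negation.Core using (¬_; contradiction)
open import Relation.Unary using (Pred; _⊆_; _≐_)

module Bounds {A : Set} (_≤_ : Rel A 0ℓ) where

  UpperBound LowerBound : Pred A 0ℓ → Pred A 0ℓ
  UpperBound S b = ∀ x → S x → x ≤ b
  LowerBound S b = ∀ x → S x → b ≤ x

  IsSupremum IsInfimum IsMinimum : Pred A 0ℓ → Pred A 0ℓ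
  IsSupremum S s = UpperBound S s × (∀ b → UpperBound S b → s ≤ b)
  IsInfimum  S s = LowerBound S s × (∀ b → LowerBound S b → b ≤ s)
  IsMinimum  S s = S s × LowerBound S s

-- The real numbers, axiomatised as a Dedekind-complete ordered field (the
-- axioms determine ℝ up to isomorphism).
record RealNumbers : Set (lsuc 0ℓ) where
  infix 4 _≤_
  field
    commutativeRing : CommutativeRing 0ℓ 0ℓ

  open CommutativeRing commutativeRing public
    using (_≈_; _+_; _*_; _-_; -_; 0#; 1#; +-rawMonoid)
    renaming (Carrier to ℝ)

  field
    _≤_          : Rel ℝ 0ℓ
    isTotalOrder : IsTotalOrder _≈_ _≤_
    0≉1          : ¬ (0# ≈ 1#)
    inverse      : ∀ x → ¬ (x ≈ 0#) → ∃[ y ] x * y ≈ 1#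
    +-monoˡ-≤    : ∀ z {x y} → x ≤ y → x + z ≤ y + z
    *-nonNeg     : ∀ {x y} → 0# ≤ x → 0# ≤ y → 0# ≤ x * y

  open Bounds _≤_ public

  field
    supremum : (S : Pred ℝ 0ℓ) → ∃ S → ∃ (UpperBound S) → ∃ (IsSupremum S)

  open NonStrictToStrict _≈_ _≤_ public using () renaming (_<_ to infix 4 _<_)

  infimum : (S : Pred ℝ 0ℓ) → ∃ S → ∃ (LowerBound S) → ∃ (IsInfimum S)
  infimum S (x , Sx) below with supremum (LowerBound S) below (x , λ _ lb → lb x Sx)
  ... | s , upper , least = s , (λ y Sy → least y (λ _ lb → lb y Sy)) , upper

-- Classical logic is used throughout the subject; here it is an explicit
-- parameter.
module Geometry (lem : ExcludedMiddle 0ℓ) (R : RealNumbers) where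

  open RealNumbers R public
  open RawMonoidDefinitions +-rawMonoid using (sum)

  private variable
    n m : ℕ

  -- ℝ ∪ {∞}
  ℝ∞ : Set
  ℝ∞ = ℝ ⁺

  open AddSupEquality _≈_ public using (_≈⁺_)
  open AddSupOrder _≤_ public using (_≤⁺_)

  ℝ∞-totalOrder : TotalOrder 0ℓ 0ℓ 0ℓ
  ℝ∞-totalOrder = record
    { isTotalOrder = AddSupOrder.≤⁺-isTotalOrder _≤_ isTotalOrder }

  infixl 6 _+⁺_
  _+⁺_ : ℝ∞ → ℝ∞ → ℝ∞
  [ x ] +⁺ [ y ] = [ x + y ]
  [ _ ] +⁺ ⊤⁺    = ⊤⁺
  ⊤⁺    +⁺ _     = ⊤⁺

  -- The infimum of a set that is bounded below, with inf ∅ = ∞.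
  inf⁺ : (S : Pred ℝ 0ℓ) → ∃ (LowerBound S) → ℝ∞
  inf⁺ S below = go lem
    module Inf⁺ where
    go : Dec (∃ S) → ℝ∞
    go (yes nonEmpty) = [ proj₁ (infimum S nonEmpty below) ]
    go (no  _)        = ⊤⁺

  -- inf⁺ is the minimum whenever the minimum exists.
  inf⁺-minimum : ∀ S below {s} → IsMinimum S s → inf⁺ S below ≈⁺ [ s ]
  inf⁺-minimum S below {s} (Ss , lb) = go′ lem
    where
    go′ : (d : Dec (∃ S)) → Inf⁺.go S below d ≈⁺ [ s ]
    go′ (no  empty)    = contradiction (s , Ss) empty
    go′ (yes nonEmpty) = AddSupEquality.[
      IsTotalOrder.antisym isTotalOrder (lower s Ss) (greatest s lb) ]
      where
      lower    = proj₁ (proj₂ (infimum S nonEmpty below))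
      greatest = proj₂ (proj₂ (infimum S nonEmpty below))

  -- Equality of points of Euclidean space is pointwise _≈_, so a subset is a
  -- predicate that respects _≈ᵛ_.

  ℝ^_ : ℕ → Set
  ℝ^ n = Vector ℝ n

  infix  4 _≈ᵛ_
  infixl 6 _+ᵛ_ _-ᵛ_
  infixr 7 _·ᵛ_

  _≈ᵛ_ : Rel (ℝ^ n) 0ℓ
  _≈ᵛ_ = Pointwise _≈_

  0ᵛ : ℝ^ n
  0ᵛ = replicate _ 0#

  _+ᵛ_ _-ᵛ_ : ℝ^ n → ℝ^ n → ℝ^ n
  _+ᵛ_ = zipWith _+_
  _-ᵛ_ = zipWith _-_

  -ᵛ_ : ℝ^ n → ℝ^ n
  -ᵛ x = Vector.map (λ t → - t) x

  _·ᵛ_ : ℝ → ℝ^ n → ℝ^ n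
  t ·ᵛ x = Vector.map (t *_) x

  ⟨_,_⟩ : ℝ^ n → ℝ^ n → ℝ
  ⟨ x , y ⟩ = sum (zipWith _*_ x y)

  linComb : Vector ℝ m → Vector (ℝ^ n) m → ℝ^ n
  linComb c v a = sum (λ k → c k * v k a)

  Subset : ℕ → Set₁
  Subset n = Pred (ℝ^ n) 0ℓ

  -- ‖ y - x ‖ < ε, squared to avoid the square root; used for ε > 0 only.
  Ball : ℝ^ n → ℝ → Subset n
  Ball x ε y = ⟨ y -ᵛ x , y -ᵛ x ⟩ < ε * ε

  Span : Subset n → Subset n
  Span {n} S x = ∃[ m ] ∃[ c ] ∃[ v ] (∀ (k : Fin m) → S (v k)) × x ≈ᵛ linComb {m} {n} c v

  record IsSubspace (V : Subset n) : Set where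
    field
      respects : V Respects _≈ᵛ_
      0∈       : V 0ᵛ
      +-closed : ∀ {x y} → V x → V y → V (x +ᵛ y)
      ·-closed : ∀ t {x} → V x → V (t ·ᵛ x)

  LinearlyIndependent : Vector (ℝ^ n) m → Set
  LinearlyIndependent v = ∀ c → linComb c v ≈ᵛ 0ᵛ → ∀ k → c k ≈ 0#

  record HasDimension (V : Subset n) (m : ℕ) : Set where
    field
      basis       : Vector (ℝ^ n) m
      basis∈      : ∀ k → V (basis k)
      independent : LinearlyIndependent basis
      spanning    : ∀ x → V x → ∃[ c ] x ≈ᵛ linComb c basis

  infix 9 _⊥
  _⊥ : Subset n → Subset n
  (V ⊥) x = ∀ y → V y → ⟨ x , y ⟩ ≈ 0#

  -- y = π_V(x)
  IsOrthogonalProjection : Subset n → ℝ^ n → ℝ^ n → Set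
  IsOrthogonalProjection V x y = V y × (V ⊥) (x -ᵛ y)

  -- The image π_V(A)
  π[_] : Subset n → Subset n → Subset n
  π[ V ] A y = ∃[ x ] A x × IsOrthogonalProjection V x y

  -- A parametrisation p + lin{v₁,…,vₘ} of an m-dimensional affine
  -- subspace contained in the linear subspace W.
  record AffineSubspace (W : Subset n) (m : ℕ) : Set where
    field
      point       : ℝ^ n
      point∈      : W point
      direction   : Vector (ℝ^ n) m
      direction∈  : ∀ k → W (direction k)
      independent : LinearlyIndependent direction

  ⟦_⟧ : ∀ {W : Subset n} → AffineSubspace W m → Subset n
  ⟦ A ⟧ x = ∃[ c ] x ≈ᵛ point +ᵛ linComb c direction
    where open AffineSubspace A

  IsConvex : Subset n → Set
  IsConvex K = ∀ {x y} t → 0# ≤ t → t ≤ 1# → K x → K y → K ((1# - t) ·ᵛ x +ᵛ t ·ᵛ y)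

  IsOpen : Subset n → Set
  IsOpen O = ∀ x → O x → ∃[ ε ] 0# < ε × Ball x ε ⊆ O

  IsCompact : Subset n → Set₁
  IsCompact {n} K =
    (I : Set) (O : I → Subset n) → (∀ i → IsOpen (O i)) →
    (∀ x → K x → ∃[ i ] O i x) →
    ∃[ is ] (∀ x → K x → Any (λ i → O i x) is)

  AffineHull : Subset n → Subset n
  AffineHull {n} S x =
    ∃[ m ] ∃[ c ] ∃[ v ] (∀ (k : Fin m) → S (v k)) × sum c ≈ 1# × x ≈ᵛ linComb {m} {n} c v

  record IsConvexBody (K : Subset n) : Set₁ where
    field
      respects        : K Respects _≈ᵛ_
      convex          : IsConvex K
      compact         : IsCompact K
      fullDimensional : ∀ x → AffineHull K x

  record IsLattice (Λ : Subset n) : Set where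
    field
      respects : Λ Respects _≈ᵛ_
      0∈       : Λ 0ᵛ
      +-closed : ∀ {x y} → Λ x → Λ y → Λ (x +ᵛ y)
      -‿closed : ∀ {x} → Λ x → Λ (-ᵛ x)
      discrete : ∀ x → Λ x → ∃[ ε ] 0# < ε × (∀ y → Λ y → Ball x ε y → y ≈ᵛ x)
      fullRank : ∀ x → Span Λ x

  IsRational : Subset n → Subset n → Set₁
  IsRational Λ V = ∃[ S ] S ⊆ Λ × V ≐ Span S

  -- μ C + Γ
  dilate+ : ℝ → Subset n → Subset n → Subset n
  dilate+ μ C Γ x = ∃[ c ] ∃[ g ] C c × Γ g × x ≈ᵛ μ ·ᵛ c +ᵛ g

  -- Here and below W is a linear subspace of ℝⁿ and k is its dimension.
  Covers : (W : Subset n) (k i : ℕ) (C Γ : Subset n) → Pred ℝ 0ℓ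
  Covers W k i C Γ μ =
    0# ≤ μ × ((A : AffineSubspace W (k ∸ i)) → ∃[ x ] dilate+ μ C Γ x × ⟦ A ⟧ x)

  -- The value is ∞ if no dilate of C works, which can happen when C is not
  -- full-dimensional in W.
  coveringMinimum : (W : Subset n) (k i : ℕ) (C Γ : Subset n) → ℝ∞
  coveringMinimum W k zero    C Γ = [ 0# ]
  coveringMinimum W k (suc i) C Γ = inf⁺ (Covers W k (suc i) C Γ) (0# , λ _ → proj₁)

  -- The j with 0 ≤ j ≤ ℓ and 0 ≤ i - j ≤ d - ℓ.
  splittings : (d ℓ i : ℕ) → List ℕ
  splittings d ℓ i =
    filter (λ j → (j ℕ.≤? i) ×-dec ((i ∸ j) ℕ.≤? (d ∸ ℓ))) (upTo (suc ℓ))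

  -- Maximum of nonnegative terms; the default value 0 is immaterial for
  -- nonempty js.
  max⁺ : List ℕ → (ℕ → ℝ∞) → ℝ∞
  max⁺ js f = Extrema.max ℝ∞-totalOrder [ 0# ] (map f js)

{-# OPTIONS --safe #-}
-- Let A be an affine subspace of dimension d - i with direction space L, and
-- let p = dim π_V(L) and q = dim (L ∩ V⊥), so that p + q = d - i. For j = ℓ - p
-- the image π_V(A) has dimension ℓ - j, hence meets μπ_V(K) + π_V(Λ) as soon as
-- μ exceeds the j-th covering minimum; say π_V(μk + h) ∈ π_V(A). Then
-- (A - μk - h) ∩ V⊥ is an affine subspace of V⊥ of dimension
-- q = (d - ℓ) - (i - j), hence contains a point νl + g of
-- ν(K ∩ V⊥) + (Λ ∩ V⊥). So A contains (μk + νl) + (h + g), and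
-- μk + νl ∈ (μ + ν)K by convexity. Covering minima are infima here, so the
-- estimate is made up to an arbitrary ε > 0, using tK ⊆ uK for t ≤ u (as 0 ∈ K).
module Submission where

open import Defs
open import Algebra.Bundles using (CommutativeRing; RawRing)
import Algebra.Properties.AbelianGroup as AbelianGroupProperties
import Algebra.Properties.CommutativeSemigroup as CommutativeSemigroupProperties
import Algebra.Properties.Ring as RingProperties
import Algebra.Properties.Semiring.Mult.TCOptimised as SemiringMult
import Algebra.Properties.Semiring.Sum as SemiringSum
import Algebra.Solver.Ring as RingSolver
open import Algebra.Solver.Ring.AlmostCommutativeRing using (_-Raw-AlmostCommutative⟶_; fromCommutativeRing)
open import Axiom.ExcludedMiddle using (ExcludedMiddle)
open import Data.Fin.Base using (zero; suc; _↑ˡ_; _↑ʳ_; splitAt; join)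
import Data.Fin.Properties as Fin
open import Data.List.Base using (map)
import Data.List.Extrema as Extrema
open import Data.List.Membership.Propositional using (_∈_)
open import Data.List.Membership.Propositional.Properties using (∈-map⁺; ∈-filter⁺; ∈-upTo⁺)
import Data.List.Relation.Unary.All as All
open import Data.Maybe.Base using (Maybe; just; nothing)
open import Data.Nat.Base as ℕ using (ℕ; zero; suc; _∸_)
import Data.Nat.Properties as ℕ
open import Data.Nat.Solver using (module +-*-Solver)
open import Data.Product.Base using (∃; ∃-syntax; _×_; _,_; proj₁; proj₂)
open import Data.Sum.Base using (inj₁; inj₂)
open import Data.Vec.Functional using (Vector; _∷_; _++_)
import Data.Vec.Functional.Properties as Vector
open import Function.Base using (_∘_)
open import Level using (0ℓ)
import Relation.Binary.Construct.Add.Supremum.NonStrict as AddSupOrder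
open import Relation.Binary.PropositionalEquality.Core as ≡ using (_≡_)
open import Relation.Binary.PropositionalEquality.Properties using (module ≡-Reasoning)
import Relation.Binary.Reasoning.Setoid as ≈-Reasoning
open import Relation.Binary.Structures using (IsTotalOrder)
open import Relation.Nullary.Construct.Add.Supremum using ([_]; ⊤⁺)
open import Relation.Nullary.Decidable.Core using (Dec; yes; no; _×-dec_)
open import Relation.Nullary.Negation.Core using (¬_; contradiction)
open import Relation.Unary using (U; _∩_)

-- Ring identities in an abstract commutative ring.

-- A ring solver whose coefficients are formal differences m - n of natural
-- numbers, so that cancellations are recognised in an abstract ring.
module DifferenceSolver (CR : CommutativeRing 0ℓ 0ℓ) where

  open CommutativeRing CR
  open AbelianGroupProperties +-abelianGroup using (⁻¹-∙-comm; ⁻¹-anti-homo‿-)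
  open CommutativeSemigroupProperties +-commutativeSemigroup using (interchange)
  open RingProperties ring using (x[y-z]≈xy-xz; [y-z]x≈yx-zx; x∙y⁻¹≈ε⇒x≈y; x≈y⇒x∙y⁻¹≈ε; -0#≈0#)
  open SemiringMult semiring using (×-homo-+; ×1-homo-*) renaming (_×_ to _×′_)
  open ≈-Reasoning setoid

  private
    ι : ℕ → Carrier
    ι n = n ×′ 1#

    -- The first clause makes 0 and 1 denote 0# and 1# definitionally.
    value : ℕ × ℕ → Carrier
    value (a , zero)  = ι a
    value (a , suc b) = ι a - ι (suc b)

    value≈ : ∀ a b → value (a , b) ≈ ι a - ι b
    value≈ a zero    = sym (trans (+-congˡ -0#≈0#) (+-identityʳ _))
    value≈ a (suc b) = refl

    [a-b]+[c-d]≈[a+c]-[b+d] : ∀ a b c d → (a - b) + (c - d) ≈ (a + c) - (b + d)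
    [a-b]+[c-d]≈[a+c]-[b+d] a b c d = trans (interchange a (- b) c (- d)) (+-congˡ (⁻¹-∙-comm b d))

    [a-b]*[c-d]≈[ac+bd]-[ad+bc] : ∀ a b c d → (a - b) * (c - d) ≈ (a * c + b * d) - (a * d + b * c)
    [a-b]*[c-d]≈[ac+bd]-[ad+bc] a b c d = begin
      (a - b) * (c - d)                  ≈⟨ [y-z]x≈yx-zx (c - d) a b ⟩
      a * (c - d) - b * (c - d)          ≈⟨ +-cong (x[y-z]≈xy-xz a c d) (-‿cong (x[y-z]≈xy-xz b c d)) ⟩
      (a * c - a * d) - (b * c - b * d)  ≈⟨ +-congˡ (⁻¹-anti-homo‿- (b * c) (b * d)) ⟩
      (a * c - a * d) + (b * d - b * c)  ≈⟨ [a-b]+[c-d]≈[a+c]-[b+d] _ _ _ _ ⟩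
      (a * c + b * d) - (a * d + b * c)  ∎

    value-cong : ∀ a b c d → a ℕ.+ d ≡ c ℕ.+ b → value (a , b) ≈ value (c , d)
    value-cong a b c d a+d≡c+b = begin
      value (a , b)  ≈⟨ value≈ a b ⟩
      ι a - ι b      ≈⟨ x∙y⁻¹≈ε⇒x≈y _ _ (begin
        (ι a - ι b) - (ι c - ι d)  ≈⟨ +-congˡ (⁻¹-anti-homo‿- (ι c) (ι d)) ⟩
        (ι a - ι b) + (ι d - ι c)  ≈⟨ [a-b]+[c-d]≈[a+c]-[b+d] _ _ _ _ ⟩
        (ι a + ι d) - (ι b + ι c)  ≈⟨ x≈y⇒x∙y⁻¹≈ε (begin
          ι a + ι d      ≈⟨ ×-homo-+ 1# a d ⟨
          ι (a ℕ.+ d)    ≡⟨ ≡.cong ι a+d≡c+b ⟩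
          ι (c ℕ.+ b)    ≈⟨ ×-homo-+ 1# c b ⟩
          ι c + ι b      ≈⟨ +-comm _ _ ⟩
          ι b + ι c      ∎) ⟩
        0#                         ∎) ⟩
      ι c - ι d      ≈⟨ value≈ c d ⟨
      value (c , d)  ∎

    -- At most one component of the result is nonzero, so every integer has a unique reduced
    -- representative and coefficients stay small under the ring operations.
    reduce : ℕ × ℕ → ℕ × ℕ
    reduce (a , b) = a ∸ b , b ∸ a

    value-reduce : ∀ a b → value (reduce (a , b)) ≈ ι a - ι b
    value-reduce a b = trans (value-cong (a ∸ b) (b ∸ a) a b ([a∸b]+b≡a+[b∸a] a b)) (value≈ a b)
      where
      [a∸b]+b≡a+[b∸a] : ∀ a b → a ∸ b ℕ.+ b ≡ a ℕ.+ (b ∸ a)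
      [a∸b]+b≡a+[b∸a] zero    b       = ≡.cong (ℕ._+ b) (ℕ.0∸n≡0 b)
      [a∸b]+b≡a+[b∸a] (suc a) zero    = ≡.refl
      [a∸b]+b≡a+[b∸a] (suc a) (suc b) = ≡.trans (ℕ.+-suc (a ∸ b) b) (≡.cong suc ([a∸b]+b≡a+[b∸a] a b))

    differenceRing : RawRing 0ℓ 0ℓ
    differenceRing = record
      { Carrier = ℕ × ℕ
      ; _≈_     = _≡_
      ; _+_     = λ { (a , b) (c , d) → reduce (a ℕ.+ c , b ℕ.+ d) }
      ; _*_     = λ { (a , b) (c , d) → reduce (a ℕ.* c ℕ.+ b ℕ.* d , a ℕ.* d ℕ.+ b ℕ.* c) }
      ; -_      = λ { (a , b) → b , a }
      ; 0#      = 0 , 0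
      ; 1#      = 1 , 0
      }

    homomorphism : differenceRing -Raw-AlmostCommutative⟶ fromCommutativeRing CR
    homomorphism = record
      { ⟦_⟧    = value
      ; +-homo = λ { (a , b) (c , d) → begin
          value (reduce (a ℕ.+ c , b ℕ.+ d))  ≈⟨ value-reduce (a ℕ.+ c) (b ℕ.+ d) ⟩
          ι (a ℕ.+ c) - ι (b ℕ.+ d)           ≈⟨ +-cong (×-homo-+ 1# a c) (-‿cong (×-homo-+ 1# b d)) ⟩
          (ι a + ι c) - (ι b + ι d)           ≈⟨ [a-b]+[c-d]≈[a+c]-[b+d] _ _ _ _ ⟨
          (ι a - ι b) + (ι c - ι d)           ≈⟨ +-cong (value≈ a b) (value≈ c d) ⟨
          value (a , b) + value (c , d)       ∎ }
      ; *-homo = λ { (a , b) (c , d) → begin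
          value (reduce (a ℕ.* c ℕ.+ b ℕ.* d , a ℕ.* d ℕ.+ b ℕ.* c))
            ≈⟨ value-reduce (a ℕ.* c ℕ.+ b ℕ.* d) (a ℕ.* d ℕ.+ b ℕ.* c) ⟩
          ι (a ℕ.* c ℕ.+ b ℕ.* d) - ι (a ℕ.* d ℕ.+ b ℕ.* c)
            ≈⟨ +-cong (ι-dot a c b d) (-‿cong (ι-dot a d b c)) ⟩
          (ι a * ι c + ι b * ι d) - (ι a * ι d + ι b * ι c)
            ≈⟨ [a-b]*[c-d]≈[ac+bd]-[ad+bc] _ _ _ _ ⟨
          (ι a - ι b) * (ι c - ι d)
            ≈⟨ *-cong (value≈ a b) (value≈ c d) ⟨
          value (a , b) * value (c , d)
            ∎ }
      ; -‿homo = λ { (a , b) → begin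
          value (b , a)    ≈⟨ value≈ b a ⟩
          ι b - ι a        ≈⟨ ⁻¹-anti-homo‿- (ι a) (ι b) ⟨
          - (ι a - ι b)    ≈⟨ -‿cong (value≈ a b) ⟨
          - value (a , b)  ∎ }
      ; 0-homo = refl
      ; 1-homo = refl
      }
      where
      ι-dot : ∀ a c b d → ι (a ℕ.* c ℕ.+ b ℕ.* d) ≈ ι a * ι c + ι b * ι d
      ι-dot a c b d = trans (×-homo-+ 1# (a ℕ.* c) (b ℕ.* d)) (+-cong (×1-homo-* a c) (×1-homo-* b d))

    -- The formal differences are compared as integers, by cross addition. The answer `nothing` does
    -- not claim that the values differ, which could fail in positive characteristic.
    value≟ : ∀ x y → Maybe (value x ≈ value y)
    value≟ (a , b) (c , d) with a ℕ.+ d ℕ.≟ c ℕ.+ b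
    ... | no  _       = nothing
    ... | yes a+d≡c+b = just (value-cong a b c d a+d≡c+b)

  open RingSolver differenceRing (fromCommutativeRing CR) homomorphism value≟ public
    using (solve; _:+_; _:*_; _:-_; :-_; con; _:=_)

-- Inequalities in an ordered field.

module OrderedField (lem : ExcludedMiddle 0ℓ) (R : RealNumbers) where

  open RealNumbers R
  open CommutativeRing commutativeRing
    using (setoid; refl; sym; trans; +-cong; +-congˡ; +-congʳ; *-congˡ; *-congʳ; -‿cong;
           +-comm; +-identityˡ; +-identityʳ; *-identityˡ; *-identityʳ; *-assoc; zeroˡ;
           -‿inverseʳ)
  open DifferenceSolver commutativeRing
  module ≤ = IsTotalOrder isTotalOrder

  +-mono-≤ : ∀ {w x y z} → w ≤ x → y ≤ z → w + y ≤ x + z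
  +-mono-≤ {w} {x} {y} {z} w≤x y≤z = ≤.trans (+-monoˡ-≤ y w≤x)
    (≤.trans (≤.reflexive (+-comm x y)) (≤.trans (+-monoˡ-≤ x y≤z) (≤.reflexive (+-comm z x))))

  +-nonNeg : ∀ {x y} → 0# ≤ x → 0# ≤ y → 0# ≤ x + y
  +-nonNeg 0≤x 0≤y = ≤.trans (≤.reflexive (sym (+-identityˡ 0#))) (+-mono-≤ 0≤x 0≤y)

  x≤y⇒0≤y-x : ∀ {x y} → x ≤ y → 0# ≤ y - x
  x≤y⇒0≤y-x {x} x≤y = ≤.trans (≤.reflexive (sym (-‿inverseʳ x))) (+-monoˡ-≤ (- x) x≤y)

  0≤y-x⇒x≤y : ∀ {x y} → 0# ≤ y - x → x ≤ y
  0≤y-x⇒x≤y {x} {y} 0≤y-x = ≤.trans (≤.reflexive (sym (+-identityˡ x)))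
    (≤.trans (+-monoˡ-≤ x 0≤y-x) (≤.reflexive (solve 2 (λ x y → (y :- x) :+ x := y) refl x y)))

  x≤x+y : ∀ x {y} → 0# ≤ y → x ≤ x + y
  x≤x+y x 0≤y = ≤.trans (≤.reflexive (sym (+-identityʳ x))) (+-mono-≤ ≤.refl 0≤y)

  0≤x*x : ∀ x → 0# ≤ x * x
  0≤x*x x with ≤.total 0# x
  ... | inj₁ 0≤x = *-nonNeg 0≤x 0≤x
  ... | inj₂ x≤0 = ≤.trans (*-nonNeg 0≤-x 0≤-x)
    (≤.reflexive (solve 1 (λ x → (con (0 , 0) :- x) :* (con (0 , 0) :- x) := x :* x) refl x))
    where 0≤-x = x≤y⇒0≤y-x x≤0

  x*x≈0⇒x≈0 : ∀ x → x * x ≈ 0# → x ≈ 0#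
  x*x≈0⇒x≈0 x x*x≈0 with lem {P = x ≈ 0#}
  ... | yes x≈0 = x≈0
  ... | no  x≉0 with inverse x x≉0
  ...   | y , x*y≈1 = begin
    x            ≈⟨ *-identityʳ x ⟨
    x * 1#       ≈⟨ *-congˡ x*y≈1 ⟨
    x * (x * y)  ≈⟨ *-assoc x x y ⟨
    x * x * y    ≈⟨ *-congʳ x*x≈0 ⟩
    0# * y       ≈⟨ zeroˡ y ⟩
    0#           ∎
    where open ≈-Reasoning setoid

  -- Here y = x y², a product of nonnegative factors.
  inverse-nonNeg : ∀ {x y} → 0# ≤ x → x * y ≈ 1# → 0# ≤ y
  inverse-nonNeg {x} {y} 0≤x x*y≈1 = ≤.trans (*-nonNeg 0≤x (0≤x*x y)) (≤.reflexive (begin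
    x * (y * y)  ≈⟨ *-assoc x y y ⟨
    x * y * y    ≈⟨ *-congʳ x*y≈1 ⟩
    1# * y       ≈⟨ *-identityˡ y ⟩
    y            ∎))
    where open ≈-Reasoning setoid

  nonNeg-+≈0ˡ : ∀ {x y} → 0# ≤ x → 0# ≤ y → x + y ≈ 0# → x ≈ 0#
  nonNeg-+≈0ˡ {x} 0≤x 0≤y x+y≈0 = ≤.antisym (≤.trans (x≤x+y x 0≤y) (≤.reflexive x+y≈0)) 0≤x

  nonNeg-+≈0ʳ : ∀ {x y} → 0# ≤ x → 0# ≤ y → x + y ≈ 0# → y ≈ 0#
  nonNeg-+≈0ʳ 0≤x 0≤y x+y≈0 = nonNeg-+≈0ˡ 0≤y 0≤x (trans (+-comm _ _) x+y≈0)

  -- Supplies the weight r = s/t of a convex combination; r ≤ 1 because 1 - r = (t - s)/t is a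
  -- product of nonnegative factors.
  ratio : ∀ {s t} → 0# ≤ s → s ≤ t → ¬ (t ≈ 0#) → ∃[ r ] 0# ≤ r × r ≤ 1# × t * r ≈ s
  ratio {s} {t} 0≤s s≤t t≉0 with inverse t t≉0
  ... | u , t*u≈1 = s * u , *-nonNeg 0≤s 0≤u , 0≤y-x⇒x≤y 0≤1-su , (begin
    t * (s * u)  ≈⟨ solve 3 (λ s t u → t :* (s :* u) := t :* u :* s) refl s t u ⟩
    t * u * s    ≈⟨ *-congʳ t*u≈1 ⟩
    1# * s       ≈⟨ *-identityˡ s ⟩
    s            ∎)
    where
    open ≈-Reasoning setoid
    0≤u = inverse-nonNeg (≤.trans 0≤s s≤t) t*u≈1
    0≤1-su = ≤.trans (*-nonNeg (x≤y⇒0≤y-x s≤t) 0≤u) (≤.reflexive (begin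
      (t - s) * u     ≈⟨ solve 3 (λ s t u → (t :- s) :* u := t :* u :- s :* u) refl s t u ⟩
      t * u - s * u   ≈⟨ +-congʳ t*u≈1 ⟩
      1# - s * u      ∎))

  0≤1 : 0# ≤ 1#
  0≤1 = ≤.trans (0≤x*x 1#) (≤.reflexive (*-identityˡ 1#))

  -- Division by 2 is possible because 1 + 1 = 0, with both summands nonnegative, would force 1 = 0.
  half : ∀ {x} → 0# < x → ∃[ h ] 0# < h × h + h ≈ x
  half {x} (0≤x , 0≉x) with inverse (1# + 1#) (λ 2≈0 → 0≉1 (sym (nonNeg-+≈0ˡ 0≤1 0≤1 2≈0)))
  ... | u , 2*u≈1 = x * u , (*-nonNeg 0≤x (inverse-nonNeg (+-nonNeg 0≤1 0≤1) 2*u≈1) ,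
      λ 0≈h → 0≉x (trans (trans (sym (+-identityˡ 0#)) (+-cong 0≈h 0≈h)) h+h≈x)) , h+h≈x
    where
    open ≈-Reasoning setoid
    h+h≈x = begin
      x * u + x * u      ≈⟨ solve 2 (λ x u → x :* u :+ x :* u := (con (1 , 0) :+ con (1 , 0)) :* u :* x) refl x u ⟩
      (1# + 1#) * u * x  ≈⟨ *-congʳ 2*u≈1 ⟩
      1# * x             ≈⟨ *-identityˡ x ⟩
      x                  ∎

  x<x+ε : ∀ x {ε} → 0# < ε → x < x + ε
  x<x+ε x {ε} (0≤ε , 0≉ε) = x≤x+y x 0≤ε , λ x≈x+ε → 0≉ε (begin
    0#            ≈⟨ -‿inverseʳ x ⟨
    x - x         ≈⟨ +-congʳ x≈x+ε ⟩
    (x + ε) - x   ≈⟨ solve 2 (λ x ε → (x :+ ε) :- x := ε) refl x ε ⟩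
    ε             ∎)
    where open ≈-Reasoning setoid

  -- If y < x, then ε = h with 2h = x - y is too small: x ≤ y + h gives h ≤ 0.
  ≤-+-approx : ∀ {x y} → (∀ ε → 0# < ε → x ≤ y + ε) → x ≤ y
  ≤-+-approx {x} {y} approx with ≤.total x y | lem {P = y ≈ x}
  ... | inj₁ x≤y | _       = x≤y
  ... | inj₂ _   | yes y≈x = ≤.reflexive (sym y≈x)
  ... | inj₂ y≤x | no  y≉x with half {x - y} (x≤y⇒0≤y-x y≤x , λ 0≈x-y → y≉x (begin
      y              ≈⟨ +-identityˡ y ⟨
      0# + y         ≈⟨ +-congʳ 0≈x-y ⟩
      (x - y) + y    ≈⟨ solve 2 (λ x y → (x :- y) :+ y := x) refl x y ⟩
      x              ∎))
      where open ≈-Reasoning setoid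
  ...   | h , 0<h@(0≤h , 0≉h) , h+h≈x-y = contradiction (≤.antisym 0≤h h≤0) 0≉h
    where
    open ≈-Reasoning setoid
    h≤0 = 0≤y-x⇒x≤y (≤.trans (x≤y⇒0≤y-x (approx h 0<h)) (≤.reflexive (begin
      (y + h) - x         ≈⟨ solve 3 (λ x y h → (y :+ h) :- x := h :- (x :- y)) refl x y h ⟩
      h - (x - y)         ≈⟨ +-congˡ (-‿cong h+h≈x-y) ⟨
      h - (h + h)         ≈⟨ solve 1 (λ h → h :- (h :+ h) := con (0 , 0) :- h) refl h ⟩
      0# - h              ∎)))

-- Linear combinations and subspaces.

module LinearAlgebra (lem : ExcludedMiddle 0ℓ) (R : RealNumbers) where

  open Geometry lem R
  open OrderedField lem R
  open CommutativeRing commutativeRing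
    using (setoid; semiring; refl; sym; trans; +-cong; +-congˡ; +-congʳ; *-congˡ; *-congʳ;
           -‿cong; +-assoc; +-identityˡ; +-identityʳ; *-identityˡ; *-identityʳ; *-assoc;
           *-comm; zeroˡ; zeroʳ; -‿inverseʳ; distribʳ; distribˡ)
  open SemiringSum semiring
  open DifferenceSolver commutativeRing
  open ≈-Reasoning setoid

  private variable
    m n p q k : ℕ
    W : Subset n

  linComb-congˡ : ∀ {c d : Vector ℝ m} (v : Vector (ℝ^ n) m) → c ≈ᵛ d → linComb c v ≈ᵛ linComb d v
  linComb-congˡ v c≈d a = sum-cong-≋ (λ k → *-congʳ (c≈d k))

  linComb-congʳ : ∀ (c : Vector ℝ m) {v w : Vector (ℝ^ n) m} →
    (∀ k → v k ≈ᵛ w k) → linComb c v ≈ᵛ linComb c w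
  linComb-congʳ c v≈w a = sum-cong-≋ (λ k → *-congˡ (v≈w k a))

  linComb-+ˡ : ∀ (c d : Vector ℝ m) (v : Vector (ℝ^ n) m) →
    linComb (c +ᵛ d) v ≈ᵛ linComb c v +ᵛ linComb d v
  linComb-+ˡ c d v a = trans (sum-cong-≋ (λ k → distribʳ (v k a) (c k) (d k)))
    (∑-distrib-+ (λ k → c k * v k a) (λ k → d k * v k a))

  linComb-+ʳ : ∀ (c : Vector ℝ m) (v w : Vector (ℝ^ n) m) →
    linComb c (λ k → v k +ᵛ w k) ≈ᵛ linComb c v +ᵛ linComb c w
  linComb-+ʳ c v w a = trans (sum-cong-≋ (λ k → distribˡ (c k) (v k a) (w k a)))
    (∑-distrib-+ (λ k → c k * v k a) (λ k → c k * w k a))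

  linComb-·ˡ : ∀ t (c : Vector ℝ m) (v : Vector (ℝ^ n) m) →
    linComb (t ·ᵛ c) v ≈ᵛ t ·ᵛ linComb c v
  linComb-·ˡ t c v a = trans (sum-cong-≋ (λ k → *-assoc t (c k) (v k a)))
    (sym (*-distribˡ-sum t (λ k → c k * v k a)))

  linComb-0ˡ : ∀ (v : Vector (ℝ^ n) m) → linComb 0ᵛ v ≈ᵛ 0ᵛ
  linComb-0ˡ {m = m} v a = trans (sum-cong-≋ (λ k → zeroˡ (v k a))) (sum-replicate-zero m)

  -- Associativity of matrix multiplication, by interchanging the two sums; it converts between
  -- coordinates with respect to nested families.
  linComb-linComb : ∀ (c : Vector ℝ m) (M : Vector (ℝ^ k) m) (v : Vector (ℝ^ n) k) →
    linComb c (λ k → linComb (M k) v) ≈ᵛ linComb (linComb c M) v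
  linComb-linComb c M v a = begin
    sum (λ k → c k * sum (λ l → M k l * v l a))    ≈⟨ sum-cong-≋ (λ k → *-distribˡ-sum (c k) (λ l → M k l * v l a)) ⟩
    sum (λ k → sum (λ l → c k * (M k l * v l a)))  ≈⟨ ∑-comm (λ k l → c k * (M k l * v l a)) ⟩
    sum (λ l → sum (λ k → c k * (M k l * v l a)))  ≈⟨ sum-cong-≋ (λ l → begin
      sum (λ k → c k * (M k l * v l a))              ≈⟨ sum-cong-≋ (λ k → *-assoc (c k) (M k l) (v l a)) ⟨
      sum (λ k → c k * M k l * v l a)                ≈⟨ *-distribʳ-sum (v l a) (λ k → c k * M k l) ⟨
      sum (λ k → c k * M k l) * v l a                ∎) ⟩
    sum (λ l → sum (λ k → c k * M k l) * v l a)    ∎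

  linComb∈ : IsSubspace W → ∀ (c : Vector ℝ m) {v : Vector (ℝ^ n) m} → (∀ k → W (v k)) → W (linComb c v)
  linComb∈ {m = zero}  sub c v∈ = IsSubspace.0∈ sub
  linComb∈ {m = suc m} sub c v∈ =
    IsSubspace.+-closed sub (IsSubspace.·-closed sub (c zero) (v∈ zero)) (linComb∈ sub (c ∘ suc) (v∈ ∘ suc))

  -closed : IsSubspace W → ∀ {x y : ℝ^ n} → W x → W y → W (x -ᵛ y)
  -closed sub {x} {y} x∈ y∈ = respects
    (λ a → solve 2 (λ x y → x :+ (:- con (1 , 0)) :* y := x :- y) refl (x a) (y a))
    (+-closed x∈ (·-closed (- 1#) y∈))
    where open IsSubspace sub

  0-subspace : IsSubspace {n} (_≈ᵛ 0ᵛ)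
  0-subspace = record
    { respects = λ x≈y x≈0 a → trans (sym (x≈y a)) (x≈0 a)
    ; 0∈       = λ _ → refl
    ; +-closed = λ x≈0 y≈0 a → trans (+-cong (x≈0 a) (y≈0 a)) (+-identityˡ 0#)
    ; ·-closed = λ t x≈0 a → trans (*-congˡ (x≈0 a)) (zeroʳ t)
    }

  -- Spans, independence modulo a subspace and adapted bases.

  InSpan : Vector (ℝ^ n) m → Subset n
  InSpan v x = ∃[ c ] x ≈ᵛ linComb c v

  InSpan-subspace : (v : Vector (ℝ^ n) m) → IsSubspace (InSpan v)
  InSpan-subspace v = record
    { respects = λ { x≈y (c , x≈) → c , λ a → trans (sym (x≈y a)) (x≈ a) }
    ; 0∈       = 0ᵛ , λ a → sym (linComb-0ˡ v a)
    ; +-closed = λ { (c , x≈) (d , y≈) → c +ᵛ d , λ a → trans (+-cong (x≈ a) (y≈ a)) (sym (linComb-+ˡ c d v a)) }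
    ; ·-closed = λ { t (c , x≈) → t ·ᵛ c , λ a → trans (*-congˡ (x≈ a)) (sym (linComb-·ˡ t c v a)) }
    }

  head∈InSpan : (v : Vector (ℝ^ n) (suc m)) → InSpan v (v zero)
  head∈InSpan v = 1# ∷ 0ᵛ , λ a → sym (trans (+-cong (*-identityˡ _) (linComb-0ˡ (v ∘ suc) a)) (+-identityʳ _))

  tail∈InSpan : (v : Vector (ℝ^ n) (suc m)) → ∀ {x} → InSpan (v ∘ suc) x → InSpan v x
  tail∈InSpan v (c , x≈) = 0# ∷ c , λ a → trans (x≈ a) (sym (trans (+-congʳ (zeroˡ _)) (+-identityˡ _)))

  -- For W = {0} this is LinearlyIndependent.
  IndependentModulo : Subset n → Vector (ℝ^ n) m → Set
  IndependentModulo W v = ∀ c → W (linComb c v) → ∀ k → c k ≈ 0#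

  -- If the coefficient of x were nonzero, dividing by it would put x plus a combination of v into
  -- W. So it vanishes, and the independence of v settles the others.
  ∷-independent : IsSubspace W → ∀ {x} {v : Vector (ℝ^ n) m} → IndependentModulo W v →
    (∀ c → ¬ W (x +ᵛ linComb c v)) → IndependentModulo W (x ∷ v)
  ∷-independent {W = W} sub {x} {v} ind x∉ c c∈ with lem {P = c zero ≈ 0#}
  ... | yes c₀≈0 = λ { zero → c₀≈0 ; (suc k) → ind (c ∘ suc) tail∈ k }
    where
    tail∈ : W (linComb (c ∘ suc) v)
    tail∈ = IsSubspace.respects sub
      (λ a → trans (+-congʳ (trans (*-congʳ c₀≈0) (zeroˡ _))) (+-identityˡ _)) c∈
  ... | no c₀≉0 with inverse (c zero) c₀≉0
  ...   | s , c₀*s≈1 = contradiction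
    (IsSubspace.respects sub (λ a → begin
      s * (c zero * x a + linComb (c ∘ suc) v a)
        ≈⟨ solve 4 (λ s c x l → s :* (c :* x :+ l) := c :* s :* x :+ s :* l)
             refl s (c zero) (x a) (linComb (c ∘ suc) v a) ⟩
      c zero * s * x a + s * linComb (c ∘ suc) v a
        ≈⟨ +-cong (trans (*-congʳ c₀*s≈1) (*-identityˡ _)) (sym (linComb-·ˡ s (c ∘ suc) v a)) ⟩
      x a + linComb (s ·ᵛ (c ∘ suc)) v a
        ∎)
      (IsSubspace.·-closed sub s c∈))
    (x∉ (s ·ᵛ (c ∘ suc)))

  tail-independent : {v : Vector (ℝ^ n) (suc m)} → LinearlyIndependent v → LinearlyIndependent (v ∘ suc)
  tail-independent ind c c≈0 k =
    ind (0# ∷ c) (λ a → trans (+-congʳ (zeroˡ _)) (trans (+-identityˡ _) (c≈0 a))) (suc k)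

  -- A basis of lin u adapted to W: the a's are a basis of lin u modulo W, the
  -- b's a basis of lin u ∩ W.
  record Splitting (W : Subset n) {m} (u : Vector (ℝ^ n) m) : Set where
    field
      {rank nullity} : ℕ
      rank+nullity≡m : rank ℕ.+ nullity ≡ m
      a              : Vector (ℝ^ n) rank
      b              : Vector (ℝ^ n) nullity
      a∈span         : ∀ k → InSpan u (a k)
      b∈span         : ∀ k → InSpan u (b k)
      b∈W            : ∀ k → W (b k)
      a-independent  : IndependentModulo W a
      b-independent  : LinearlyIndependent b

  -- Induction on the family. If some combination of the a's corrects the new vector into W, the
  -- corrected vector joins the b's; otherwise the new vector itself joins the a's.
  split : IsSubspace W → (u : Vector (ℝ^ n) m) → LinearlyIndependent u → Splitting W u
  split {m = zero} sub u ind = record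
    { rank = 0 ; nullity = 0 ; rank+nullity≡m = ≡.refl ; a = λ () ; b = λ ()
    ; a∈span = λ () ; b∈span = λ () ; b∈W = λ ()
    ; a-independent = λ _ _ () ; b-independent = λ _ _ () }
  split {W = W} {m = suc m} sub u ind = extend (lem {P = ∃[ c ] W (u zero +ᵛ linComb c a)})
    where
    open Splitting (split sub (u ∘ suc) (tail-independent {v = u} ind))

    extend : Dec (∃[ c ] W (u zero +ᵛ linComb c a)) → Splitting W u
    extend (no u₀∉) = record
      { rank+nullity≡m = ≡.cong suc rank+nullity≡m ; a = u zero ∷ a ; b = b
      ; a∈span = λ { zero → head∈InSpan u ; (suc k) → tail∈InSpan u (a∈span k) }
      ; b∈span = tail∈InSpan u ∘ b∈span
      ; b∈W = b∈W
      ; a-independent = ∷-independent sub a-independent (λ c c∈ → u₀∉ (c , c∈))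
      ; b-independent = b-independent }
    extend (yes (c , b₀∈W)) = record
      { rank+nullity≡m = ≡.trans (ℕ.+-suc rank nullity) (≡.cong suc rank+nullity≡m) ; a = a ; b = b₀ ∷ b
      ; a∈span = tail∈InSpan u ∘ a∈span
      ; b∈span = λ { zero → IsSubspace.+-closed (InSpan-subspace u) (head∈InSpan u)
                       (tail∈InSpan u (linComb∈ tailSpan c a∈span))
                   ; (suc k) → tail∈InSpan u (b∈span k) }
      ; b∈W = λ { zero → b₀∈W ; (suc k) → b∈W k }
      ; a-independent = a-independent
      ; b-independent = ∷-independent 0-subspace b-independent b₀∉ }
      where
      tailSpan = InSpan-subspace (u ∘ suc)
      b₀ = u zero +ᵛ linComb c a
      -- Such a relation would be a vanishing combination of u in which `u zero` has coefficient 1,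
      -- since the a's and b's lie in the span of the tail.
      b₀∉ : ∀ d → ¬ (b₀ +ᵛ linComb d b ≈ᵛ 0ᵛ)
      b₀∉ d b₀+≈0 with IsSubspace.+-closed tailSpan (linComb∈ tailSpan c a∈span) (linComb∈ tailSpan d b∈span)
      ... | e , ≈e = 0≉1 (sym (ind (1# ∷ e) (λ i → begin
        1# * u zero i + linComb e (u ∘ suc) i         ≈⟨ +-cong (*-identityˡ _) (sym (≈e i)) ⟩
        u zero i + (linComb c a i + linComb d b i)    ≈⟨ +-assoc _ _ _ ⟨
        u zero i + linComb c a i + linComb d b i      ≈⟨ b₀+≈0 i ⟩
        0#                                            ∎) zero))

  -- Bounds on the size of independent families.

  hyperplane-subspace : IsSubspace {suc n} (λ x → x zero ≈ 0#)
  hyperplane-subspace = record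
    { respects = λ x≈y x₀≈0 → trans (sym (x≈y zero)) x₀≈0
    ; 0∈       = refl
    ; +-closed = λ x₀≈0 y₀≈0 → trans (+-cong x₀≈0 y₀≈0) (+-identityˡ 0#)
    ; ·-closed = λ t x₀≈0 → trans (*-congˡ x₀≈0) (zeroʳ t)
    }

  -- Let x and y be the first coordinates of two members v₀ and v₁. The combination y v₀ - x v₁ lies
  -- in the hyperplane, so x = 0; but then v₀ lies there too, with coefficient 1.
  independent-modulo-hyperplane⇒≤1 : (v : Vector (ℝ^ (suc n)) p) →
    IndependentModulo (λ x → x zero ≈ 0#) v → p ℕ.≤ 1
  independent-modulo-hyperplane⇒≤1 {p = 0}           v ind = ℕ.z≤n
  independent-modulo-hyperplane⇒≤1 {p = 1}           v ind = ℕ.s≤s ℕ.z≤n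
  independent-modulo-hyperplane⇒≤1 {p = suc (suc p)} v ind = contradiction (sym 1≈0) 0≉1
    where
    x = v zero zero
    y = v (suc zero) zero
    rest = linComb-0ˡ (λ k → v (suc (suc k))) zero
    -x≈0 : - x ≈ 0#
    -x≈0 = ind (y ∷ - x ∷ 0ᵛ) (trans (+-congˡ (+-congˡ rest))
      (solve 2 (λ x y → y :* x :+ ((:- x) :* y :+ con (0 , 0)) := con (0 , 0)) refl x y)) (suc zero)
    1≈0 : 1# ≈ 0#
    1≈0 = ind (1# ∷ 0# ∷ 0ᵛ) (begin
      1# * x + (0# * y + linComb 0ᵛ (λ k → v (suc (suc k))) zero)  ≈⟨ +-congˡ (+-congˡ rest) ⟩
      1# * x + (0# * y + 0#)  ≈⟨ solve 2 (λ x y → con (1 , 0) :* x :+ (con (0 , 0) :* y :+ con (0 , 0)) := :- (:- x))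
                                   refl x y ⟩
      - (- x)                 ≈⟨ -‿cong -x≈0 ⟩
      - 0#                    ≈⟨ solve 0 (:- con (0 , 0) := con (0 , 0)) refl ⟩
      0#                      ∎) zero

  -- Induction on the ambient dimension. Splitting along the hyperplane of vanishing first
  -- coordinate leaves at most one vector modulo it, and the others stay independent after that
  -- coordinate is dropped.
  independent⇒≤ : (v : Vector (ℝ^ n) m) → LinearlyIndependent v → m ℕ.≤ n
  independent⇒≤ {zero}  {zero}  v ind = ℕ.z≤n
  independent⇒≤ {zero}  {suc m} v ind = contradiction (sym (ind (λ _ → 1#) (λ ()) zero)) 0≉1
  independent⇒≤ {suc n} {m}     v ind = ≡.subst (ℕ._≤ suc n) rank+nullity≡m
    (ℕ.+-mono-≤ (independent-modulo-hyperplane⇒≤1 a a-independent)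
                 (independent⇒≤ (λ k → b k ∘ suc) tails-independent))
    where
    open Splitting (split hyperplane-subspace v ind)
    tails-independent : LinearlyIndependent (λ k → b k ∘ suc)
    tails-independent c c≈0 = b-independent c λ { zero → linComb∈ hyperplane-subspace c {b} b∈W ; (suc i) → c≈0 i }

  -- An upper bound on the dimension that mentions no basis, so that it can be had for `V ⊥` from a
  -- basis of `V`.
  MaxRank : Subset n → ℕ → Set
  MaxRank W k = ∀ {m} (v : Vector _ m) → (∀ l → W (v l)) → LinearlyIndependent v → m ℕ.≤ k

  -- The coordinate vectors with respect to the basis are independent in `ℝ^ k`.
  dimension⇒maxRank : {V : Subset n} → HasDimension V k → MaxRank V k
  dimension⇒maxRank {k = k} hasDim v v∈ ind = independent⇒≤ coeffs (λ c c≈0 → ind c (λ a → begin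
      linComb c v a                                 ≈⟨ linComb-congʳ c (λ l → proj₂ (spanning (v l) (v∈ l))) a ⟩
      linComb c (λ l → linComb (coeffs l) basis) a  ≈⟨ linComb-linComb c coeffs basis a ⟩
      linComb (linComb c coeffs) basis a            ≈⟨ linComb-congˡ basis c≈0 a ⟩
      linComb 0ᵛ basis a                            ≈⟨ linComb-0ˡ basis a ⟩
      0#                                            ∎))
    where
    open HasDimension hasDim
    coeffs : Vector (ℝ^ k) _
    coeffs l = proj₁ (spanning (v l) (v∈ l))

  -- Otherwise x could be adjoined to v, exceeding the maximal rank. The conclusion says that the
  -- affine subspace x + lin v passes through the origin, the form in which it is applied.
  spans : IsSubspace W → MaxRank W k → (v : Vector (ℝ^ n) k) → (∀ l → W (v l)) → LinearlyIndependent v →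
    ∀ x → W x → ∃[ c ] x +ᵛ linComb c v ≈ᵛ 0ᵛ
  spans {k = k} sub maxRank v v∈ ind x x∈ with lem {P = ∃[ c ] x +ᵛ linComb c v ≈ᵛ 0ᵛ}
  ... | yes ∃c = ∃c
  ... | no ∄c = contradiction
    (maxRank (x ∷ v) (λ { zero → x∈ ; (suc l) → v∈ l }) (∷-independent 0-subspace ind (λ c c≈0 → ∄c (c , c≈0))))
    (ℕ.<⇒≱ (ℕ.n<1+n k))

  -- Concatenation of families.

  sum-++ : ∀ p {q} (f : Vector ℝ (p ℕ.+ q)) → sum f ≈ sum (f ∘ (_↑ˡ q)) + sum (f ∘ (p ↑ʳ_))
  sum-++ zero    f = sym (+-identityˡ _)
  sum-++ (suc p) f = trans (+-congˡ (sum-++ p (f ∘ suc))) (sym (+-assoc _ _ _))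

  linComb-++ : ∀ (c : Vector ℝ (p ℕ.+ q)) (v : Vector (ℝ^ n) p) (w : Vector (ℝ^ n) q) →
    linComb c (v ++ w) ≈ᵛ linComb (c ∘ (_↑ˡ q)) v +ᵛ linComb (c ∘ (p ↑ʳ_)) w
  linComb-++ {p} {q} c v w a = trans (sum-++ p _) (+-cong
    (sum-cong-≋ (λ k → *-congˡ {c (k ↑ˡ q)} (≡⇒≈ (≡.cong (λ x → x a) (Vector.lookup-++ˡ v w k)))))
    (sum-cong-≋ (λ k → *-congˡ {c (p ↑ʳ k)} (≡⇒≈ (≡.cong (λ x → x a) (Vector.lookup-++ʳ v w k))))))
    where
    ≡⇒≈ : ∀ {x y} → x ≡ y → x ≈ y
    ≡⇒≈ ≡.refl = refl

  -- In a vanishing combination the v-part is minus the w-part, hence lies in W, and its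
  -- coefficients vanish. What remains is a relation among w.
  ++-independent : IsSubspace W → (v : Vector (ℝ^ n) p) (w : Vector (ℝ^ n) q) → IndependentModulo W v →
    (∀ l → W (w l)) → LinearlyIndependent w → LinearlyIndependent (v ++ w)
  ++-independent {W = W} {p = p} {q = q} sub v w v-ind w∈ w-ind c c≈0 k =
    ≡.subst (λ k → c k ≈ 0#) (Fin.join-splitAt p q k) (zeroAt (splitAt p k))
    where
    c₁ = c ∘ (_↑ˡ q)
    c₂ = c ∘ (p ↑ʳ_)
    c₁≈0 : c₁ ≈ᵛ 0ᵛ
    c₁≈0 = v-ind c₁ (IsSubspace.respects sub (λ a → begin
      - 1# * linComb c₂ w a                                ≈⟨ +-identityˡ _ ⟨
      0# + - 1# * linComb c₂ w a                           ≈⟨ +-congʳ (trans (sym (linComb-++ c v w a)) (c≈0 a)) ⟨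
      linComb c₁ v a + linComb c₂ w a + - 1# * linComb c₂ w a
        ≈⟨ solve 2 (λ x y → x :+ y :+ (:- con (1 , 0)) :* y := x) refl (linComb c₁ v a) (linComb c₂ w a) ⟩
      linComb c₁ v a                                       ∎)
      (IsSubspace.·-closed sub (- 1#) (linComb∈ sub c₂ w∈)))
    c₂≈0 : c₂ ≈ᵛ 0ᵛ
    c₂≈0 = w-ind c₂ (λ a → begin
      linComb c₂ w a                   ≈⟨ +-identityˡ _ ⟨
      0# + linComb c₂ w a              ≈⟨ +-congʳ (trans (linComb-congˡ v c₁≈0 a) (linComb-0ˡ v a)) ⟨
      linComb c₁ v a + linComb c₂ w a  ≈⟨ linComb-++ c v w a ⟨
      linComb c (v ++ w) a             ≈⟨ c≈0 a ⟩
      0#                               ∎)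
    zeroAt : ∀ s → c (join p q s) ≈ 0#
    zeroAt (inj₁ k) = c₁≈0 k
    zeroAt (inj₂ k) = c₂≈0 k

  -- Inner product, orthogonal complement and projection.

  ⟨⟩-congˡ : ∀ {x y : ℝ^ n} z → x ≈ᵛ y → ⟨ x , z ⟩ ≈ ⟨ y , z ⟩
  ⟨⟩-congˡ z x≈y = sum-cong-≋ (λ a → *-congʳ (x≈y a))

  ⟨⟩-comm : ∀ (x y : ℝ^ n) → ⟨ x , y ⟩ ≈ ⟨ y , x ⟩
  ⟨⟩-comm x y = sum-cong-≋ (λ a → *-comm (x a) (y a))

  ⟨⟩-+ˡ : ∀ (x y z : ℝ^ n) → ⟨ x +ᵛ y , z ⟩ ≈ ⟨ x , z ⟩ + ⟨ y , z ⟩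
  ⟨⟩-+ˡ x y z = trans (sum-cong-≋ (λ a → distribʳ (z a) (x a) (y a)))
    (∑-distrib-+ (λ a → x a * z a) (λ a → y a * z a))

  ⟨⟩-·ˡ : ∀ t (x z : ℝ^ n) → ⟨ t ·ᵛ x , z ⟩ ≈ t * ⟨ x , z ⟩
  ⟨⟩-·ˡ t x z = trans (sum-cong-≋ (λ a → *-assoc t (x a) (z a))) (sym (*-distribˡ-sum t (λ a → x a * z a)))

  -- With linearity in this form, `linComb∈` extends orthogonality from a family to its span.
  annihilator-subspace : (z : ℝ^ n) → IsSubspace (λ x → ⟨ x , z ⟩ ≈ 0#)
  annihilator-subspace {n} z = record
    { respects = λ x≈y x⊥z → trans (sym (⟨⟩-congˡ z x≈y)) x⊥z
    ; 0∈       = trans (sum-cong-≋ (λ a → zeroˡ (z a))) (sum-replicate-zero n)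
    ; +-closed = λ {x} {y} x⊥z y⊥z → trans (⟨⟩-+ˡ x y z) (trans (+-cong x⊥z y⊥z) (+-identityˡ 0#))
    ; ·-closed = λ t {x} x⊥z → trans (⟨⟩-·ˡ t x z) (trans (*-congˡ x⊥z) (zeroʳ t))
    }

  ⊥-subspace : (V : Subset n) → IsSubspace (V ⊥)
  ⊥-subspace V = record
    { respects = λ x≈y x∈ z z∈ → IsSubspace.respects (annihilator-subspace z) x≈y (x∈ z z∈)
    ; 0∈       = λ z _ → IsSubspace.0∈ (annihilator-subspace z)
    ; +-closed = λ x∈ y∈ z z∈ → IsSubspace.+-closed (annihilator-subspace z) (x∈ z z∈) (y∈ z z∈)
    ; ·-closed = λ t x∈ z z∈ → IsSubspace.·-closed (annihilator-subspace z) t (x∈ z z∈)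
    }

  sum-squares-nonNeg : ∀ (x : ℝ^ n) → 0# ≤ ⟨ x , x ⟩
  sum-squares-nonNeg {zero}  x = ≤.refl
  sum-squares-nonNeg {suc n} x = +-nonNeg (0≤x*x (x zero)) (sum-squares-nonNeg (x ∘ suc))

  ⟨x,x⟩≈0⇒x≈0 : ∀ (x : ℝ^ n) → ⟨ x , x ⟩ ≈ 0# → x ≈ᵛ 0ᵛ
  ⟨x,x⟩≈0⇒x≈0 {suc n} x ⟨x,x⟩≈0 zero =
    x*x≈0⇒x≈0 (x zero) (nonNeg-+≈0ˡ (0≤x*x (x zero)) (sum-squares-nonNeg (x ∘ suc)) ⟨x,x⟩≈0)
  ⟨x,x⟩≈0⇒x≈0 {suc n} x ⟨x,x⟩≈0 (suc a) =
    ⟨x,x⟩≈0⇒x≈0 (x ∘ suc) (nonNeg-+≈0ʳ (0≤x*x (x zero)) (sum-squares-nonNeg (x ∘ suc)) ⟨x,x⟩≈0) a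

  V∩V⊥⊆0 : {V : Subset n} → ∀ {x} → V x → (V ⊥) x → x ≈ᵛ 0ᵛ
  V∩V⊥⊆0 {x = x} x∈V x∈V⊥ = ⟨x,x⟩≈0⇒x≈0 x (x∈V⊥ x x∈V)

  -- Since V and V⊥ meet only in 0, a basis of V is independent modulo V⊥; followed by v it is an
  -- independent family in ℝⁿ.
  dimension⇒⊥-maxRank : {V : Subset n} → IsSubspace V → HasDimension V k → ∀ {m} (v : Vector _ m) →
    (∀ l → (V ⊥) (v l)) → LinearlyIndependent v → k ℕ.+ m ℕ.≤ n
  dimension⇒⊥-maxRank {V = V} sub hasDim v v∈ ind = independent⇒≤ (basis ++ v)
    (++-independent (⊥-subspace V) basis v
      (λ c c∈ → independent c (V∩V⊥⊆0 {V = V} (linComb∈ sub c basis∈) c∈)) v∈ ind)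
    where open HasDimension hasDim

  -- Gram–Schmidt without normalisation.
  orthogonalDecomposition : (v : Vector (ℝ^ n) m) → ∀ x → ∃[ y ] ∃[ z ] InSpan v y × (InSpan v ⊥) z × x ≈ᵛ y +ᵛ z
  orthogonalDecomposition {m = zero} v x = 0ᵛ , x , IsSubspace.0∈ (InSpan-subspace v) ,
    (λ w (_ , w≈0) → trans (⟨⟩-comm x w)
      (IsSubspace.respects (annihilator-subspace x) (λ a → sym (w≈0 a)) (IsSubspace.0∈ (annihilator-subspace x)))) ,
    λ a → sym (+-identityˡ _)
  orthogonalDecomposition {m = suc m} v x
    with orthogonalDecomposition (v ∘ suc) (v zero) | orthogonalDecomposition (v ∘ suc) x
  ... | y₀ , z₀ , y₀∈ , z₀∈ , v₀≈ | y₁ , z₁ , y₁∈ , z₁∈ , x≈ = go (lem {P = ⟨ z₀ , z₀ ⟩ ≈ 0#})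
    where
    open IsSubspace (InSpan-subspace v)

    -- Because `v zero` is y₀ + z₀ with y₀ in the span of the tail, orthogonality to the tail and to
    -- z₀ is enough.
    ⊥-extend : ∀ {z} → (InSpan (v ∘ suc) ⊥) z → ⟨ z , z₀ ⟩ ≈ 0# → (InSpan v ⊥) z
    ⊥-extend {z} z∈ z⊥z₀ w (c , w≈) = trans (⟨⟩-comm z w)
      (IsSubspace.respects ann (λ a → sym (w≈ a)) (linComb∈ ann c v⊥z))
      where
      ann = annihilator-subspace z
      v⊥z : ∀ k → ⟨ v k , z ⟩ ≈ 0#
      v⊥z zero    = IsSubspace.respects ann (λ a → sym (v₀≈ a))
        (IsSubspace.+-closed ann (trans (⟨⟩-comm y₀ z) (z∈ y₀ y₀∈)) (trans (⟨⟩-comm z₀ z) z⊥z₀))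
      v⊥z (suc k) = trans (⟨⟩-comm (v (suc k)) z) (z∈ (v (suc k)) (vₖ∈ k))
        where
        vₖ∈ : ∀ {m} {u : Vector (ℝ^ _) m} k → InSpan u (u k)
        vₖ∈ {u = u} zero    = head∈InSpan u
        vₖ∈ {u = u} (suc k) = tail∈InSpan u (vₖ∈ k)

    go : Dec (⟨ z₀ , z₀ ⟩ ≈ 0#) → ∃[ y ] ∃[ z ] InSpan v y × (InSpan v ⊥) z × x ≈ᵛ y +ᵛ z
    -- Here z₀ = 0: the first vector already lies in the span of the tail, whose decomposition of x
    -- serves unchanged.
    go (yes z₀²≈0) = y₁ , z₁ , tail∈InSpan v y₁∈ , ⊥-extend z₁∈ z₁⊥z₀ , x≈
      where
      z₁⊥z₀ : ⟨ z₁ , z₀ ⟩ ≈ 0#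
      z₁⊥z₀ = trans (⟨⟩-comm z₁ z₀)
        (IsSubspace.respects (annihilator-subspace z₁) (λ a → sym (⟨x,x⟩≈0⇒x≈0 z₀ z₀²≈0 a))
          (IsSubspace.0∈ (annihilator-subspace z₁)))
    go (no z₀²≉0) with inverse ⟨ z₀ , z₀ ⟩ z₀²≉0
    ... | s , z₀²*s≈1 = y₁ +ᵛ t ·ᵛ z₀ , z₁ +ᵛ (- t) ·ᵛ z₀ ,
        +-closed (tail∈InSpan v y₁∈) (·-closed t z₀∈span) ,
        ⊥-extend (IsSubspace.+-closed ⊥tail z₁∈ (IsSubspace.·-closed ⊥tail (- t) z₀∈)) z⊥z₀ ,
        λ a → trans (x≈ a)
          (solve 4 (λ y z t w → y :+ z := (y :+ t :* w) :+ (z :+ (:- t) :* w)) refl (y₁ a) (z₁ a) t (z₀ a))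
      where
      ⊥tail = ⊥-subspace (InSpan (v ∘ suc))
      -- The coefficient ⟨z₁,z₀⟩ / ⟨z₀,z₀⟩ of the component of z₁ along z₀.
      t = ⟨ z₁ , z₀ ⟩ * s
      z₀∈span : InSpan v z₀
      z₀∈span = respects (λ a → trans (+-congʳ (v₀≈ a)) (solve 2 (λ y z → (y :+ z) :- y := z) refl (y₀ a) (z₀ a)))
        (-closed (InSpan-subspace v) (head∈InSpan v) (tail∈InSpan v y₀∈))
      z⊥z₀ : ⟨ z₁ +ᵛ (- t) ·ᵛ z₀ , z₀ ⟩ ≈ 0#
      z⊥z₀ = begin
        ⟨ z₁ +ᵛ (- t) ·ᵛ z₀ , z₀ ⟩
          ≈⟨ ⟨⟩-+ˡ z₁ ((- t) ·ᵛ z₀) z₀ ⟩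
        ⟨ z₁ , z₀ ⟩ + ⟨ (- t) ·ᵛ z₀ , z₀ ⟩
          ≈⟨ +-congˡ (⟨⟩-·ˡ (- t) z₀ z₀) ⟩
        ⟨ z₁ , z₀ ⟩ + - t * ⟨ z₀ , z₀ ⟩
          ≈⟨ solve 3 (λ a b s → a :+ (:- (a :* s)) :* b := a :- a :* (b :* s)) refl ⟨ z₁ , z₀ ⟩ ⟨ z₀ , z₀ ⟩ s ⟩
        ⟨ z₁ , z₀ ⟩ - ⟨ z₁ , z₀ ⟩ * (⟨ z₀ , z₀ ⟩ * s)
          ≈⟨ +-congˡ (-‿cong (trans (*-congˡ z₀²*s≈1) (*-identityʳ _))) ⟩
        ⟨ z₁ , z₀ ⟩ - ⟨ z₁ , z₀ ⟩
          ≈⟨ -‿inverseʳ _ ⟩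
        0#
          ∎

  project : {V : Subset n} → IsSubspace V → HasDimension V k → ∀ x → ∃[ y ] IsOrthogonalProjection V x y
  project {V = V} sub hasDim x with orthogonalDecomposition (HasDimension.basis hasDim) x
  ... | y , z , (c , y≈) , z∈ , x≈ = y , respects (λ a → sym (y≈ a)) (linComb∈ sub c basis∈) ,
      λ w w∈ → IsSubspace.respects (⊥-subspace (InSpan basis)) (λ a → sym (begin
        x a - y a            ≈⟨ +-congʳ (x≈ a) ⟩
        (y a + z a) - y a    ≈⟨ solve 2 (λ y z → (y :+ z) :- y := z) refl (y a) (z a) ⟩
        z a                  ∎)) z∈ w (spanning w w∈)
    where
    open IsSubspace sub
    open HasDimension hasDim

  module OrthogonalProjection {V : Subset n} (sub : IsSubspace V) (hasDim : HasDimension V k) where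

    π residue : ℝ^ n → ℝ^ n
    π x       = proj₁ (project sub hasDim x)
    residue x = x -ᵛ π x

    π∈ : ∀ x → V (π x)
    π∈ x = proj₁ (proj₂ (project sub hasDim x))

    residue∈V⊥ : ∀ x → (V ⊥) (residue x)
    residue∈V⊥ x = proj₂ (proj₂ (project sub hasDim x))

    -- Stands in for the linearity of π: a combination is a vector of V⊥ plus the same combination
    -- of the projections.
    linComb-π+residue : ∀ c (v : Vector (ℝ^ n) m) → linComb c v ≈ᵛ linComb c (residue ∘ v) +ᵛ linComb c (π ∘ v)
    linComb-π+residue c v a = trans
      (linComb-congʳ c (λ l a → solve 2 (λ x y → x := (x :- y) :+ y) refl (v l a) (π (v l) a)) a)
      (linComb-+ʳ c (residue ∘ v) (π ∘ v) a)

    linComb-residue∈ : ∀ c (v : Vector (ℝ^ n) m) → (V ⊥) (linComb c (residue ∘ v))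
    linComb-residue∈ c v = linComb∈ (⊥-subspace V) c (residue∈V⊥ ∘ v)

    -- If a combination of the projections vanishes, the same combination of v equals that of the
    -- residues and so lies in V⊥.
    π-independent : (v : Vector (ℝ^ n) m) → IndependentModulo (V ⊥) v → LinearlyIndependent (π ∘ v)
    π-independent v ind c c≈0 = ind c (IsSubspace.respects (⊥-subspace V)
      (λ a → sym (trans (linComb-π+residue c v a) (trans (+-congˡ (c≈0 a)) (+-identityʳ _)))) (linComb-residue∈ c v))

-- Choice of the index j.

-- Writing ℓ = p + j and d = ℓ + q + r turns truncated subtractions into sums. Cancelling p + q
-- gives i = j + r, whence i - j = r and d - ℓ = q + r.
splitting-arithmetic : ∀ {d ℓ i p q} → i ℕ.≤ d → p ℕ.+ q ≡ d ∸ i → p ℕ.≤ ℓ → ℓ ℕ.+ q ℕ.≤ d →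
  ∃[ j ] j ℕ.≤ ℓ × j ℕ.≤ i × i ∸ j ℕ.≤ d ∸ ℓ × ℓ ∸ j ≡ p × (d ∸ ℓ) ∸ (i ∸ j) ≡ q
splitting-arithmetic {i = i} {p} {q} i≤d p+q≡d∸i p≤ℓ ℓ+q≤d with ℕ.m≤n⇒∃[o]m+o≡n p≤ℓ | ℕ.m≤n⇒∃[o]m+o≡n ℓ+q≤d
... | j , ≡.refl | r , ≡.refl with i≡j+r
  where
  i≡j+r : i ≡ j ℕ.+ r
  i≡j+r = ℕ.+-cancelʳ-≡ (p ℕ.+ q) i (j ℕ.+ r) (begin
    i ℕ.+ (p ℕ.+ q)                      ≡⟨ ≡.cong (i ℕ.+_) p+q≡d∸i ⟩
    i ℕ.+ (p ℕ.+ j ℕ.+ q ℕ.+ r ∸ i)      ≡⟨ ℕ.m+[n∸m]≡n i≤d ⟩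
    p ℕ.+ j ℕ.+ q ℕ.+ r                  ≡⟨ solve 4 (λ p j q r → p :+ j :+ q :+ r := j :+ r :+ (p :+ q)) ≡.refl p j q r ⟩
    j ℕ.+ r ℕ.+ (p ℕ.+ q)                ∎)
    where
    open ≡-Reasoning
    open +-*-Solver using (solve; _:+_; _:=_)
... | ≡.refl = j , ℕ.m≤n+m j p , ℕ.m≤m+n j r , ≡.subst₂ ℕ._≤_ (≡.sym i∸j≡r) (≡.sym d∸ℓ≡q+r) (ℕ.m≤n+m r q) ,
    ℕ.m+n∸n≡m p j , ≡.trans (≡.cong₂ _∸_ d∸ℓ≡q+r i∸j≡r) (ℕ.m+n∸n≡m q r)
  where
  i∸j≡r : j ℕ.+ r ∸ j ≡ r
  i∸j≡r = ℕ.m+n∸m≡n j r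
  d∸ℓ≡q+r : p ℕ.+ j ℕ.+ q ℕ.+ r ∸ (p ℕ.+ j) ≡ q ℕ.+ r
  d∸ℓ≡q+r = ≡.trans (≡.cong (_∸ (p ℕ.+ j)) (ℕ.+-assoc (p ℕ.+ j) q r)) (ℕ.m+n∸m≡n (p ℕ.+ j) (q ℕ.+ r))

-- Infima, dilates of convex sets and the covering estimate.

module CoveringMinima (lem : ExcludedMiddle 0ℓ) (R : RealNumbers) where

  open Geometry lem R
  open OrderedField lem R
  open LinearAlgebra lem R
  open CommutativeRing commutativeRing
    using (setoid; refl; sym; trans; +-cong; +-congˡ; +-congʳ; *-congʳ; +-comm; +-identityˡ;
           zeroˡ)
  open DifferenceSolver commutativeRing

  private variable
    d k ℓ m n : ℕ

  inf⁺≤ : ∀ S below {s} → (∀ ε → 0# < ε → S (s + ε)) → inf⁺ S below ≤⁺ [ s ]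
  inf⁺≤ S below {s} S[s+ε] = go lem
    where
    go : (dec : Dec (∃ S)) → Inf⁺.go S below dec ≤⁺ [ s ]
    go (yes nonEmpty) = AddSupOrder.[ ≤-+-approx (λ ε 0<ε → proj₁ (proj₂ (infimum S nonEmpty below)) _ (S[s+ε] ε 0<ε)) ]
    -- The set contains s + 1, which rules out the value ∞ of an empty infimum.
    go (no  empty)    = contradiction (_ , S[s+ε] 1# (0≤1 , 0≉1)) empty

  -- If no element were at most y, then y would be a lower bound exceeding the infimum s.
  inf⁺-approx : ∀ S below {s y} → inf⁺ S below ≡ [ s ] → s < y → ∃[ x ] S x × x ≤ y
  inf⁺-approx S below {s} {y} = go lem
    where
    go : (dec : Dec (∃ S)) → Inf⁺.go S below dec ≡ [ s ] → s < y → ∃[ x ] S x × x ≤ y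
    go (yes nonEmpty) ≡.refl (s≤y , s≉y) with lem {P = ∃[ x ] S x × x ≤ y}
    ... | yes found = found
    ... | no  none  = contradiction (≤.antisym s≤y (proj₂ (proj₂ (infimum S nonEmpty below)) y y-lower)) s≉y
      where
      y-lower : LowerBound S y
      y-lower x Sx with ≤.total y x
      ... | inj₁ y≤x = y≤x
      ... | inj₂ x≤y = contradiction (x , Sx , x≤y) none

  +⁺-finite : ∀ x y {z} → x +⁺ y ≤⁺ [ z ] → ∃[ s ] ∃[ t ] x ≡ [ s ] × y ≡ [ t ] × s + t ≤ z
  +⁺-finite [ s ] [ t ] AddSupOrder.[ s+t≤z ] = s , t , ≡.refl , ≡.refl , s+t≤z

  ≤max⁺ : ∀ {js j} f → j ∈ js → f j ≤⁺ max⁺ js f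
  ≤max⁺ {js} f j∈js = All.lookup (Extrema.xs≤max ℝ∞-totalOrder [ 0# ] (map f js)) (∈-map⁺ f j∈js)

  0≤max⁺ : ∀ js f → [ 0# ] ≤⁺ max⁺ js f
  0≤max⁺ js f = Extrema.⊥≤max ℝ∞-totalOrder [ 0# ] (map f js)

  Meets : {W : Subset n} → ℝ → (C Γ : Subset n) → AffineSubspace W m → Set
  Meets μ C Γ A = ∃[ x ] dilate+ μ C Γ x × ⟦ A ⟧ x

  -- The convention μ₀ = 0 agrees with the general definition because a
  -- subspace of full dimension contains the origin.
  covers-approx : {W : Subset n} → IsSubspace W → MaxRank W k → ∀ i {C Γ s y} → C 0ᵛ → Γ 0ᵛ →
    coveringMinimum W k i C Γ ≡ [ s ] → s < y → ∃[ μ ] Covers W k i C Γ μ × μ ≤ y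
  covers-approx sub maxRank zero {C} {Γ} 0∈C 0∈Γ ≡.refl (0≤y , _) = 0# , (≤.refl , meets) , 0≤y
    where
    meets : ∀ A → Meets 0# C Γ A
    meets A with spans sub maxRank direction direction∈ independent point point∈
      where open AffineSubspace A
    ... | c , 0≈ = 0ᵛ , (0ᵛ , 0ᵛ , 0∈C , 0∈Γ , λ _ → sym (trans (+-congʳ (zeroˡ 0#)) (+-identityˡ 0#))) ,
      c , λ a → sym (0≈ a)
  covers-approx sub maxRank (suc i) 0∈C 0∈Γ = inf⁺-approx _ _

  -- For s + t ≠ 0 the point z is the convex combination with weight t/(s + t) on y. For s + t = 0
  -- both coefficients vanish and any point of K will do.
  convex-+ : ∀ {K : Subset n} → IsConvex K → ∀ {s t} → 0# ≤ s → 0# ≤ t → ∀ {x y} → K x → K y →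
    ∃[ z ] K z × s ·ᵛ x +ᵛ t ·ᵛ y ≈ᵛ (s + t) ·ᵛ z
  convex-+ {K = K} convex {s} {t} 0≤s 0≤t {x} {y} x∈ y∈ with lem {P = s + t ≈ 0#}
  ... | yes s+t≈0 = x , x∈ , λ a → begin
      s * x a + t * y a  ≈⟨ +-cong (trans (*-congʳ (nonNeg-+≈0ˡ 0≤s 0≤t s+t≈0)) (zeroˡ _))
                                   (trans (*-congʳ (nonNeg-+≈0ʳ 0≤s 0≤t s+t≈0)) (zeroˡ _)) ⟩
      0# + 0#            ≈⟨ +-identityˡ 0# ⟩
      0#                 ≈⟨ zeroˡ (x a) ⟨
      0# * x a           ≈⟨ *-congʳ s+t≈0 ⟨
      (s + t) * x a      ∎
    where open ≈-Reasoning setoid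
  ... | no s+t≉0 with ratio 0≤t (≤.trans (x≤x+y t 0≤s) (≤.reflexive (+-comm t s))) s+t≉0
  ...   | r , 0≤r , r≤1 , [s+t]*r≈t = _ , convex r 0≤r r≤1 x∈ y∈ , λ a → begin
      s * x a + t * y a
        ≈⟨ solve 4 (λ s t x y → s :* x :+ t :* y := (s :+ t) :* x :+ t :* (y :- x)) refl s t (x a) (y a) ⟩
      (s + t) * x a + t * (y a - x a)
        ≈⟨ +-congˡ (*-congʳ [s+t]*r≈t) ⟨
      (s + t) * x a + (s + t) * r * (y a - x a)
        ≈⟨ solve 4 (λ u r x y → u :* x :+ u :* r :* (y :- x) := u :* ((con (1 , 0) :- r) :* x :+ r :* y))
             refl (s + t) r (x a) (y a) ⟩
      (s + t) * ((1# - r) * x a + r * y a)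
        ∎
    where open ≈-Reasoning setoid

  -- The gap u - (s + t) is filled by a multiple of the origin, through a second use of convexity.
  convex-+-≤ : ∀ {K : Subset n} → IsConvex K → K 0ᵛ →
    ∀ {s t u} → 0# ≤ s → 0# ≤ t → s + t ≤ u → ∀ {x y} → K x → K y →
    ∃[ z ] K z × s ·ᵛ x +ᵛ t ·ᵛ y ≈ᵛ u ·ᵛ z
  convex-+-≤ convex 0∈K {s} {t} {u} 0≤s 0≤t s+t≤u {x} {y} x∈ y∈ with convex-+ convex 0≤s 0≤t x∈ y∈
  ... | z , z∈ , ≈z with convex-+ convex (+-nonNeg 0≤s 0≤t) (x≤y⇒0≤y-x s+t≤u) z∈ 0∈K
  ...   | w , w∈ , ≈w = w , w∈ , λ a → begin
      s * x a + t * y a                      ≈⟨ ≈z a ⟩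
      (s + t) * z a                          ≈⟨ solve 3 (λ v u z → v :* z := v :* z :+ (u :- v) :* con (0 , 0))
                                                  refl (s + t) u (z a) ⟩
      (s + t) * z a + (u - (s + t)) * 0#     ≈⟨ ≈w a ⟩
      ((s + t) + (u - (s + t))) * w a        ≈⟨ *-congʳ (solve 2 (λ v u → v :+ (u :- v) := u) refl (s + t) u) ⟩
      u * w a                                ∎
    where open ≈-Reasoning setoid

  -- The translate of A by -(μk + h) meets V⊥ in an affine subspace with
  -- direction b, where k ∈ K and h ∈ Λ lift the points found in π_V(A).
  fibre-meets : {K Λ V : Subset d} → IsConvex K → K 0ᵛ → (∀ {x y} → Λ x → Λ y → Λ (x +ᵛ y)) →
    IsSubspace V → HasDimension V ℓ → (A : AffineSubspace U m) →
    (S : Splitting (V ⊥) (AffineSubspace.direction A)) →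
    ∀ {μ ν t} → 0# ≤ μ → 0# ≤ ν → μ + ν ≤ t →
    ((A₁ : AffineSubspace V (Splitting.rank S)) → Meets μ (π[ V ] K) (π[ V ] Λ) A₁) →
    ((A₂ : AffineSubspace (V ⊥) (Splitting.nullity S)) → Meets ν (K ∩ V ⊥) (Λ ∩ V ⊥) A₂) →
    Meets t K Λ A
  fibre-meets {K = K} {Λ} {V} convex 0∈K +-closed sub hasDim A S {μ} {ν} {t} 0≤μ 0≤ν μ+ν≤t meets₁ meets₂ =
    lift (meets₁ A₁)
    where
    open ≈-Reasoning setoid
    open AffineSubspace A
    open Splitting S
    open OrthogonalProjection sub hasDim
    module V⊥ = IsSubspace (⊥-subspace V)

    A₁ : AffineSubspace V rank
    A₁ = record
      { point = π point
      ; point∈ = π∈ point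
      ; direction = π ∘ a
      ; direction∈ = π∈ ∘ a
      ; independent = π-independent a a-independent
      }

    lift : Meets μ (π[ V ] K) (π[ V ] Λ) A₁ → Meets t K Λ A
    lift (x , (k′ , h′ , (k , k∈ , _ , k-k′∈) , (h , h∈ , _ , h-h′∈) , x≈) , e , x≈e) = combine (meets₂ A₂)
      where
      A₂ : AffineSubspace (V ⊥) nullity
      A₂ = record
        { point = (point +ᵛ linComb e a) -ᵛ (μ ·ᵛ k +ᵛ h)
        ; point∈ = V⊥.respects (λ i → sym (≈residues i))
            (-closed (⊥-subspace V) (V⊥.+-closed (residue∈V⊥ point) (linComb-residue∈ e a))
              (V⊥.+-closed (V⊥.·-closed μ k-k′∈) h-h′∈))
        ; direction = b
        ; direction∈ = b∈W
        ; independent = b-independent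
        }
        where
        -- The components in V cancel: `π point` plus the combination of the `π ∘ a` and μk′ + h′
        -- are the same point x.
        ≈residues : (point +ᵛ linComb e a) -ᵛ (μ ·ᵛ k +ᵛ h) ≈ᵛ
          (residue point +ᵛ linComb e (residue ∘ a)) -ᵛ (μ ·ᵛ (k -ᵛ k′) +ᵛ (h -ᵛ h′))
        ≈residues i = begin
          (point i + linComb e a i) - (μ * k i + h i)
            ≈⟨ +-congʳ (+-congˡ (linComb-π+residue e a i)) ⟩
          (point i + (r + s)) - (μ * k i + h i)
            ≈⟨ solve 7 (λ p p′ r s u k h → (p :+ (r :+ s)) :- (u :* k :+ h) :=
                 ((p :- p′) :+ r) :+ (p′ :+ s) :- (u :* k :+ h)) refl (point i) (π point i) r s μ (k i) (h i) ⟩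
          (point i - π point i + r) + (π point i + s) - (μ * k i + h i)
            ≈⟨ +-congʳ (+-congˡ (trans (sym (x≈e i)) (x≈ i))) ⟩
          (point i - π point i + r) + (μ * k′ i + h′ i) - (μ * k i + h i)
            ≈⟨ solve 6 (λ p u k k′ h h′ → p :+ (u :* k′ :+ h′) :- (u :* k :+ h) :=
                 p :- (u :* (k :- k′) :+ (h :- h′))) refl (point i - π point i + r) μ (k i) (k′ i) (h i) (h′ i) ⟩
          (point i - π point i + r) - (μ * (k i - k′ i) + (h i - h′ i))
            ∎
          where
          r = linComb e (residue ∘ a) i
          s = linComb e (π ∘ a) i

      combine : Meets ν (K ∩ V ⊥) (Λ ∩ V ⊥) A₂ → Meets t K Λ A
      -- Adding μk + h back carries the point of A₂ into A; c holds the coordinates, in the original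
      -- directions, of the combined a- and b-parts.
      combine (y , (l , g , (l∈ , _) , (g∈ , _) , y≈) , f , y≈f)
        with convex-+-≤ convex 0∈K 0≤μ 0≤ν μ+ν≤t k∈ l∈
           | IsSubspace.+-closed (InSpan-subspace direction)
               (linComb∈ (InSpan-subspace direction) e a∈span)
               (linComb∈ (InSpan-subspace direction) f b∈span)
      ... | z , z∈ , ≈z | c , ≈c = t ·ᵛ z +ᵛ (h +ᵛ g) ,
          (z , h +ᵛ g , z∈ , +-closed h∈ g∈ , λ _ → refl) , c , λ i → begin
        t * z i + (h i + g i)
          ≈⟨ +-congʳ (≈z i) ⟨
        μ * k i + ν * l i + (h i + g i)
          ≈⟨ solve 4 (λ mk nl h g → mk :+ nl :+ (h :+ g) := (mk :+ h) :+ (nl :+ g))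
               refl (μ * k i) (ν * l i) (h i) (g i) ⟩
        μ * k i + h i + (ν * l i + g i)
          ≈⟨ +-congˡ (trans (sym (y≈ i)) (y≈f i)) ⟩
        μ * k i + h i + ((point i + linComb e a i) - (μ * k i + h i) + linComb f b i)
          ≈⟨ solve 4 (λ s p x y → s :+ ((p :+ x) :- s :+ y) := p :+ (x :+ y))
               refl (μ * k i + h i) (point i) (linComb e a i) (linComb f b i) ⟩
        point i + (linComb e a i + linComb f b i)
          ≈⟨ +-congˡ (≈c i) ⟩
        point i + linComb c direction i
          ∎

  coveringMinimum-bound : (i : ℕ) (K Λ V : Subset d) → IsConvex K → K 0ᵛ →
    Λ 0ᵛ → (∀ {x y} → Λ x → Λ y → Λ (x +ᵛ y)) →
    IsSubspace V → HasDimension V ℓ → suc i ℕ.≤ d →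
    coveringMinimum U d (suc i) K Λ
      ≤⁺
    max⁺ (splittings d ℓ (suc i)) (λ j →
      coveringMinimum V ℓ j (π[ V ] K) (π[ V ] Λ)
        +⁺
      coveringMinimum (V ⊥) (d ∸ ℓ) (suc i ∸ j) (K ∩ V ⊥) (Λ ∩ V ⊥))
  coveringMinimum-bound {d} {ℓ} i K Λ V convex 0∈K 0∈Λ +-closed sub hasDim 1+i≤d =
    bound (max⁺ js f) (λ j j∈ → ≤max⁺ f j∈) (0≤max⁺ js f)
    where
    js = splittings d ℓ (suc i)

    μ₁ μ₂ f : ℕ → ℝ∞
    μ₁ j = coveringMinimum V ℓ j (π[ V ] K) (π[ V ] Λ)
    μ₂ j = coveringMinimum (V ⊥) (d ∸ ℓ) (suc i ∸ j) (K ∩ V ⊥) (Λ ∩ V ⊥)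
    f j = μ₁ j +⁺ μ₂ j

    0∈V⊥ = IsSubspace.0∈ (⊥-subspace V)
    0∈π : ∀ {A : Subset d} → A 0ᵛ → π[ V ] A 0ᵛ
    0∈π 0∈A = 0ᵛ , 0∈A , IsSubspace.0∈ sub , -closed (⊥-subspace V) 0∈V⊥ 0∈V⊥

    ⊥-maxRank : MaxRank (V ⊥) (d ∸ ℓ)
    ⊥-maxRank {m} v v∈ ind = ℕ.m+n≤o⇒m≤o∸n m
      (≡.subst (ℕ._≤ d) (ℕ.+-comm ℓ m) (dimension⇒⊥-maxRank sub hasDim v v∈ ind))

    -- Any upper bound M of the terms may replace the maximum. M = ∞ is immediate, while a finite M
    -- makes both minima in each term finite; 0 ≤ M makes M + ε an admissible dilation factor.
    bound : ∀ M → (∀ j → j ∈ js → f j ≤⁺ M) → [ 0# ] ≤⁺ M → coveringMinimum U d (suc i) K Λ ≤⁺ M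
    bound ⊤⁺    _  _                     = _ AddSupOrder.≤⊤⁺
    bound [ M ] f≤ AddSupOrder.[ 0≤M ] = inf⁺≤ _ _ covers
      where
      covers : ∀ ε → 0# < ε → Covers U d (suc i) K Λ (M + ε)
      covers ε 0<ε = +-nonNeg 0≤M (proj₁ 0<ε) , meets
        where
        meets : (A : AffineSubspace U (d ∸ suc i)) → Meets (M + ε) K Λ A
        -- One half of ε is spent on each of the two minima.
        meets A with half 0<ε
        ... | h , 0<h , h+h≈ε = go (splitting-arithmetic 1+i≤d rank+nullity≡m rank≤ℓ ℓ+nullity≤d)
          where
          S = split (⊥-subspace V) (AffineSubspace.direction A) (AffineSubspace.independent A)
          open Splitting S
          open OrthogonalProjection sub hasDim

          -- The two bounds place j = ℓ - rank in the range of the maximum. This j depends on A, so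
          -- the terms for all j must be bounded by M.
          ℓ+nullity≤d = dimension⇒⊥-maxRank sub hasDim b b∈W b-independent
          rank≤ℓ : rank ℕ.≤ ℓ
          rank≤ℓ = dimension⇒maxRank hasDim (π ∘ a) (π∈ ∘ a) (π-independent a a-independent)

          go : ∃[ j ] j ℕ.≤ ℓ × j ℕ.≤ suc i × suc i ∸ j ℕ.≤ d ∸ ℓ × ℓ ∸ j ≡ rank × (d ∸ ℓ) ∸ (suc i ∸ j) ≡ nullity →
            Meets (M + ε) K Λ A
          go (j , j≤ℓ , j≤i , i∸j≤ , ℓ∸j≡ , ≡nullity)
            with +⁺-finite (μ₁ j) (μ₂ j) (f≤ j (∈-filter⁺ (λ j → (j ℕ.≤? suc i) ×-dec ((suc i ∸ j) ℕ.≤? (d ∸ ℓ)))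
                                                 (∈-upTo⁺ (ℕ.s≤s j≤ℓ)) (j≤i , i∸j≤)))
          ... | s , t , μ₁≡ , μ₂≡ , s+t≤M
            with covers-approx sub (dimension⇒maxRank hasDim) j (0∈π 0∈K) (0∈π 0∈Λ) μ₁≡ (x<x+ε s 0<h)
               | covers-approx (⊥-subspace V) ⊥-maxRank (suc i ∸ j) (0∈K , 0∈V⊥) (0∈Λ , 0∈V⊥) μ₂≡ (x<x+ε t 0<h)
          ... | μ , (0≤μ , covers₁) , μ≤ | ν , (0≤ν , covers₂) , ν≤ =
            fibre-meets convex 0∈K +-closed sub hasDim A S 0≤μ 0≤ν μ+ν≤M+ε
              (≡.subst (λ p → (A₁ : AffineSubspace V p) → Meets μ (π[ V ] K) (π[ V ] Λ) A₁) ℓ∸j≡ covers₁)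
              (≡.subst (λ q → (A₂ : AffineSubspace (V ⊥) q) → Meets ν (K ∩ V ⊥) (Λ ∩ V ⊥) A₂) ≡nullity covers₂)
            where
            open ≈-Reasoning setoid
            μ+ν≤M+ε = ≤.trans (+-mono-≤ μ≤ ν≤) (≤.trans (≤.reflexive (begin
              (s + h) + (t + h)  ≈⟨ solve 3 (λ s t h → (s :+ h) :+ (t :+ h) := (s :+ t) :+ (h :+ h)) refl s t h ⟩
              (s + t) + (h + h)  ≈⟨ +-congˡ h+h≈ε ⟩
              (s + t) + ε        ∎)) (+-monoˡ-≤ ε s+t≤M))

theorem1p1 : (lem : ExcludedMiddle 0ℓ) (R : RealNumbers) →
    let open Geometry lem R in
    (d ℓ i : ℕ) (K Λ V : Subset d) →
    IsConvexBody K → K 0ᵛ →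
    IsLattice Λ →
    IsSubspace V → IsRational Λ V → HasDimension V ℓ →
    1 ℕ.≤ i → i ℕ.≤ d →
    coveringMinimum U d i K Λ
    ≤⁺
    max⁺ (splittings d ℓ i) (λ j →
    coveringMinimum V ℓ j (π[ V ] K) (π[ V ] Λ)
    +⁺
    coveringMinimum (V ⊥) (d ∸ ℓ) (i ∸ j) (K ∩ V ⊥) (Λ ∩ V ⊥))
theorem1p1 lem R d ℓ (suc i) K Λ V body 0∈K lattice sub _ hasDim _ i≤d =
  coveringMinimum-bound i K Λ V (Geometry.IsConvexBody.convex body) 0∈K
    (Geometry.IsLattice.0∈ lattice) (Geometry.IsLattice.+-closed lattice) sub hasDim i≤d
  where open CoveringMinima lem R
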